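{- $\alpha(n,3) = o(n)$, i.e. $\alpha(n,3)/n \to 0$ as $n\to\infty$.
   Context: A finite set of points in $\mathbb{R}^d$ is in general position if no hyperplane contains more than $d$ of its points. For a finite set $P\subset\mathbb{R}^d$ in which at most $d+1$ points lie on any hyperplane, $\alpha(P)$ denotes the maximum size of a subset of $P$ in general position, and $\alpha(n,d)=\min\{\alpha(P): P\subset\mathbb{R}^d,\ |P|=n,\ \text{at most } d+1 \text{ points of } P \text{ on any hyperplane}\}$. Thus $\alpha(n,3)$ is the minimum, over $n$-point sets in $\mathbb{R}^3$ with no five points on a plane, of the largest subset with no four coplanar points. -}

module Defs where

open import Level using (Level; 0ℓ; _⊔_) renaming (suc to lsuc)
open import Algebra.Bundles using (CommutativeRing)
open import Data.Nat using (ℕ) renaming (_≤_ to _≤ℕ_; _*_ to _*ℕ_)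
open import Data.Fin using (Fin; zero; suc)
open import Data.Fin.Subset using (Subset; _∈_; ∣_∣; ⊤)
open import Data.Product using (Σ; ∃; _×_; _,_)
open import Data.Sum using (_⊎_)
open import Relation.Nullary using (¬_)
open import Relation.Binary.PropositionalEquality using (_≡_; _≢_)

-- An axiomatisation of the real numbers: a complete ordered field.
-- (Any two models are isomorphic, so quantifying over all models is the
-- same as speaking about ℝ.)
record RealField : Set₁ where
  field
    field′ : CommutativeRing 0ℓ 0ℓ
  open CommutativeRing field′ public
  field
    _<_        : Carrier → Carrier → Set
    <-resp-≈   : ∀ {x x' y y'} → x ≈ x' → y ≈ y' → x < y → x' < y'
    <-irrefl   : ∀ {x} → ¬ (x < x)
    <-trans    : ∀ {x y z} → x < y → y < z → x < z
    <-tri      : ∀ x y → (x < y) ⊎ (x ≈ y) ⊎ (y < x)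
    +-mono-<   : ∀ {x y} z → x < y → (x + z) < (y + z)
    *-pos      : ∀ {x y} → 0# < x → 0# < y → 0# < (x * y)
    0<1        : 0# < 1#
    inverse    : ∀ x → ¬ (x ≈ 0#) → Σ Carrier (λ y → (x * y) ≈ 1#)
    lub        : (S : Carrier → Set) → Σ Carrier S →
                 Σ Carrier (λ u → ∀ x → S x → (x < u) ⊎ (x ≈ u)) →
                 Σ Carrier (λ s → (∀ x → S x → (x < s) ⊎ (x ≈ s)) ×
                   (∀ u → (∀ x → S x → (x < u) ⊎ (x ≈ u)) → (s < u) ⊎ (s ≈ u)))

module Geometry3 (ℝ : RealField) where
  open RealField ℝ hiding (zero)

  Point : Set
  Point = Fin 3 → Carrier

  _·_ : Point → Point → Carrier
  a · p = (a zero * p zero) + ((a (suc zero) * p (suc zero)) + (a (suc (suc zero)) * p (suc (suc zero))))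

  record Hyperplane : Set where
    field
      normal    : Point
      offset    : Carrier
      normal≠0  : ¬ (∀ i → normal i ≈ 0#)

  OnPlane : Hyperplane → Point → Set
  OnPlane H p = (Hyperplane.normal H · p) ≈ Hyperplane.offset H

  DistinctPoints : (n : ℕ) → (Fin n → Point) → Set
  DistinctPoints n P = ∀ i j → i ≢ j → ¬ (∀ c → P i c ≈ P j c)

  KOnPlane : (k : ℕ) {n : ℕ} → (Fin n → Point) → Subset n → Hyperplane → Set
  KOnPlane k {n} P S H =
    Σ (Fin k → Fin n) λ f →
      (∀ j j' → f j ≡ f j' → j ≡ j') × (∀ j → f j ∈ S) × (∀ j → OnPlane H (P (f j)))

  -- at most 4 = d+1 points of P on any hyperplane
  AtMost4OnPlane : {n : ℕ} → (Fin n → Point) → Set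
  AtMost4OnPlane {n} P = ∀ H → ¬ KOnPlane 5 P ⊤ H

  GeneralPosition : {n : ℕ} → (Fin n → Point) → Subset n → Set
  GeneralPosition P S = ∀ H → ¬ KOnPlane 4 P S H

AlphaN3IsLittleO : RealField → Set
AlphaN3IsLittleO ℝ =
  ∀ (k : ℕ) → 1 ≤ℕ k → ∃ λ N → ∀ n → N ≤ℕ n →
    Σ (Fin n → Point) λ P → DistinctPoints n P × AtMost4OnPlane P ×
      (∀ S → GeneralPosition P S → k *ℕ ∣ S ∣ ≤ℕ n)
  where open Geometry3 ℝ

{-# OPTIONS --safe #-}
module Submission where

-- A generic linear projection of the cube {0,1}ᵐ to ℝ³, x ↦ Σ xᵢ vᵢ, has no five
-- coplanar points, because an affine plane in ℝᵐ meets the cube in at most four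
-- points.  On the other hand there are only 3ᵐ possible sums x + y, so a subset
-- of the cube with many more than 3^(m/2) points contains four distinct points
-- with x + y = z + w; their images form a parallelogram and are coplanar.  Since
-- 3^(m/2) = o(2ᵐ), any n of the 2ᵐ points, with 2ᵐ ≤ 2n, give the theorem.

open import Defs
open import Level using (0ℓ)
open import Algebra.Bundles using (CommutativeRing)
open import Algebra.Solver.Ring.AlmostCommutativeRing
  using (fromCommutativeRing; _-Raw-AlmostCommutative⟶_)
import Algebra.Solver.Ring
open import Data.Bool as Bool using (Bool; true; false)
open import Data.Fin as Fin
  using (Fin; zero; suc; combine; remQuot; _↑ˡ_; _↑ʳ_; inject≤)
open import Data.Fin.Patterns using (0F; 1F; 2F; 3F)
open import Data.Fin.Properties as Fin
  using (all?; any?; combine-injective; combine-remQuot; pigeonhole; 2↔Bool;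
         splitAt-↑ˡ; splitAt-↑ʳ; inject≤-injective; ↑ˡ-injective; ↑ʳ-injective)
open import Data.Fin.Subset using (Subset; _∈_; ∣_∣; inside; outside)
open import Data.Fin.Subset.Properties using (anySubset?)
open import Data.Integer as ℤ using (ℤ; +_; -[1+_]; _⊖_; _◃_)
import Data.Integer.Properties as ℤ
open import Data.Maybe using (just; nothing)
open import Data.Nat as ℕ using (ℕ; zero; suc; ⌊_/2⌋)
import Data.Nat.Properties as ℕ
open import Data.Product using (Σ; ∃; _×_; _,_; uncurry)
open import Data.Sign as Sign using (Sign)
open import Data.Sum using (_⊎_; inj₁; inj₂)
open import Data.Vec using (Vec; []; _∷_; lookup; head; tail; tabulate; here; there)
open import Data.Vec.Properties using (∷-injective; lookup∘tabulate)
open import Data.Vec.Relation.Unary.All using ([]; _∷_)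
open import Data.Vec.Relation.Unary.AllPairs using ([]; _∷_)
open import Data.Vec.Relation.Unary.Unique.Propositional using (Unique)
open import Data.Vec.Relation.Unary.Unique.Propositional.Properties using (lookup-injective)
open import Function using (_∘_)
open import Function.Bundles using (module Inverse; module Injection)
open import Function.Properties.Inverse using (↔⇒↣)
open import Relation.Binary.Definitions using (WeaklyDecidable)
open import Relation.Binary.PropositionalEquality as ≡ using (_≡_; _≢_)
import Relation.Binary.Reasoning.Setoid
open import Relation.Nullary using (¬_; Dec; yes; no; contradiction; ¬?; _×-dec_; _⊎-dec_)
open import Relation.Nullary.Decidable using (decidable-stable; map′; toWitnessFalse)

-- The fact about plane sections is not proved inside ℝᵐ. The vectors vᵢ are chosen one at a time in
-- ℝ³, so that the points for m + 1 are the points for m together with a translate of them, and the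
-- five-point condition becomes an induction on m. Every bad position of the new vector then lies on
-- one of finitely many planes of ℝ³ whose normals are fixed by the earlier vectors. The obstacle is
-- that such a plane degenerates when its normal vanishes; so the induction also carries that no two
-- points coincide and no three are collinear. Noncollinearity serves again at the end: it gives the
-- parallelogram a nonzero normal, as `Hyperplane` demands.

-- A coefficient ring with computing decidable equality, which the ring
-- solver needs to cancel terms over an abstract commutative ring.
module IntegerCoefficients (R : CommutativeRing 0ℓ 0ℓ) where
  open CommutativeRing R hiding (zero)
  open import Algebra.Properties.Ring ring
    using (-‿distribˡ-*; -‿distribʳ-*; -0#≈0#; -‿involutive)
  open import Algebra.Properties.AbelianGroup +-abelianGroup using (⁻¹-∙-comm)
  open import Algebra.Properties.Semiring.Mult semiring
    using (×-homo-+; ×1-homo-*; ×-homo-1) renaming (_×_ to _×ₙ_)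
  open import Relation.Binary.Reasoning.Setoid setoid

  ⟦_⟧ : ℤ → Carrier
  ⟦ + n ⟧      = n ×ₙ 1#
  ⟦ -[1+ n ] ⟧ = - (suc n ×ₙ 1#)

  ⟦-⟧ : ∀ i → ⟦ ℤ.- i ⟧ ≈ - ⟦ i ⟧
  ⟦-⟧ (+ zero)     = sym -0#≈0#
  ⟦-⟧ (+ suc n)    = refl
  ⟦-⟧ -[1+ n ]     = sym (-‿involutive _)

  add-sub-cancel : ∀ a x y → x + - y ≈ (a + x) + - (a + y)
  add-sub-cancel a x y = sym (begin
    (a + x) + - (a + y)     ≈⟨ +-cong (+-comm a x) (sym (⁻¹-∙-comm a y)) ⟩
    (x + a) + (- a + - y)   ≈⟨ +-assoc x a _ ⟩
    x + (a + (- a + - y))   ≈⟨ +-congˡ (sym (+-assoc a (- a) _)) ⟩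
    x + ((a + - a) + - y)   ≈⟨ +-congˡ (trans (+-congʳ (-‿inverseʳ a)) (+-identityˡ _)) ⟩
    x + - y                 ∎)

  ⟦⊖⟧ : ∀ m n → ⟦ m ⊖ n ⟧ ≈ m ×ₙ 1# + - (n ×ₙ 1#)
  ⟦⊖⟧ zero    zero    = sym (-‿inverseʳ 0#)
  ⟦⊖⟧ zero    (suc n) = sym (+-identityˡ _)
  ⟦⊖⟧ (suc m) zero    = sym (trans (+-congˡ -0#≈0#) (+-identityʳ _))
  ⟦⊖⟧ (suc m) (suc n) = begin
    ⟦ suc m ⊖ suc n ⟧                   ≡⟨ ≡.cong ⟦_⟧ (ℤ.[1+m]⊖[1+n]≡m⊖n m n) ⟩
    ⟦ m ⊖ n ⟧                           ≈⟨ ⟦⊖⟧ m n ⟩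
    m ×ₙ 1# + - (n ×ₙ 1#)               ≈⟨ add-sub-cancel 1# _ _ ⟩
    suc m ×ₙ 1# + - (suc n ×ₙ 1#)       ∎

  ⟦+⟧ : ∀ i j → ⟦ i ℤ.+ j ⟧ ≈ ⟦ i ⟧ + ⟦ j ⟧
  ⟦+⟧ (+ m)    (+ n)    = ×-homo-+ 1# m n
  ⟦+⟧ (+ m)    -[1+ n ] = ⟦⊖⟧ m (suc n)
  ⟦+⟧ -[1+ m ] (+ n)    = trans (⟦⊖⟧ n (suc m)) (+-comm _ _)
  ⟦+⟧ -[1+ m ] -[1+ n ] = begin
    - (suc (suc (m ℕ.+ n)) ×ₙ 1#)       ≡⟨ ≡.cong (λ k → - (suc k ×ₙ 1#)) (≡.sym (ℕ.+-suc m n)) ⟩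
    - ((suc m ℕ.+ suc n) ×ₙ 1#)         ≈⟨ -‿cong (×-homo-+ 1# (suc m) (suc n)) ⟩
    - (suc m ×ₙ 1# + suc n ×ₙ 1#)       ≈⟨ ⁻¹-∙-comm _ _ ⟨
    - (suc m ×ₙ 1#) + - (suc n ×ₙ 1#)   ∎

  ⟦-◃⟧ : ∀ n → ⟦ Sign.- ◃ n ⟧ ≈ - (n ×ₙ 1#)
  ⟦-◃⟧ zero    = sym -0#≈0#
  ⟦-◃⟧ (suc n) = refl

  ⟦+◃⟧ : ∀ n → ⟦ Sign.+ ◃ n ⟧ ≈ n ×ₙ 1#
  ⟦+◃⟧ zero    = refl
  ⟦+◃⟧ (suc n) = refl

  ⟦*⟧ : ∀ i j → ⟦ i ℤ.* j ⟧ ≈ ⟦ i ⟧ * ⟦ j ⟧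
  ⟦*⟧ (+ m)    (+ n)    = trans (⟦+◃⟧ (m ℕ.* n)) (×1-homo-* m n)
  ⟦*⟧ (+ m)    -[1+ n ] = begin
    ⟦ Sign.- ◃ m ℕ.* suc n ⟧            ≈⟨ ⟦-◃⟧ (m ℕ.* suc n) ⟩
    - ((m ℕ.* suc n) ×ₙ 1#)             ≈⟨ -‿cong (×1-homo-* m (suc n)) ⟩
    - ((m ×ₙ 1#) * (suc n ×ₙ 1#))       ≈⟨ -‿distribʳ-* _ _ ⟩
    (m ×ₙ 1#) * - (suc n ×ₙ 1#)         ∎
  ⟦*⟧ -[1+ m ] (+ n)    = begin
    ⟦ Sign.- ◃ suc m ℕ.* n ⟧            ≈⟨ ⟦-◃⟧ (suc m ℕ.* n) ⟩
    - ((suc m ℕ.* n) ×ₙ 1#)             ≈⟨ -‿cong (×1-homo-* (suc m) n) ⟩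
    - ((suc m ×ₙ 1#) * (n ×ₙ 1#))       ≈⟨ -‿distribˡ-* _ _ ⟩
    - (suc m ×ₙ 1#) * (n ×ₙ 1#)         ∎
  ⟦*⟧ -[1+ m ] -[1+ n ] = begin
    (suc m ℕ.* suc n) ×ₙ 1#             ≈⟨ ×1-homo-* (suc m) (suc n) ⟩
    (suc m ×ₙ 1#) * (suc n ×ₙ 1#)       ≈⟨ -‿involutive _ ⟨
    - - ((suc m ×ₙ 1#) * (suc n ×ₙ 1#)) ≈⟨ -‿cong (-‿distribʳ-* _ _) ⟩
    - ((suc m ×ₙ 1#) * - (suc n ×ₙ 1#)) ≈⟨ -‿distribˡ-* _ _ ⟩
    - (suc m ×ₙ 1#) * - (suc n ×ₙ 1#)   ∎

  ⟦⟧-homo : ℤ.+-*-rawRing -Raw-AlmostCommutative⟶ fromCommutativeRing R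
  ⟦⟧-homo = record
    { ⟦_⟧ = ⟦_⟧ ; +-homo = ⟦+⟧ ; *-homo = ⟦*⟧ ; -‿homo = ⟦-⟧
    ; 0-homo = refl ; 1-homo = ×-homo-1 1# }

  ⟦⟧≟ : WeaklyDecidable (λ i j → ⟦ i ⟧ ≈ ⟦ j ⟧)
  ⟦⟧≟ i j with i ℤ.≟ j
  ... | yes ≡.refl = just refl
  ... | no  _      = nothing

-- Two-colourings of five points.

Cube : ℕ → Set
Cube m = Vec Bool m

Monochromatic MinorityPoint : ∀ {n} → (Fin n → Bool) → Set
Monochromatic c = ∀ i j → c i ≡ c j
MinorityPoint c = ∃ λ i → ∃ λ j → ∃ λ k → ∃ λ l →
  (i ≢ j × i ≢ k × j ≢ k) × (c i ≡ c j × c i ≡ c k × c i ≢ c l)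

-- Abstract, because the exhaustive search over the 32 colourings must not be
-- normalised where the result is used.
abstract
  five-colouring : (c : Fin 5 → Bool) → Monochromatic c ⊎ MinorityPoint c
  -- Functions cannot be enumerated up to `≡`, so the search runs over tabulated vectors and
  -- `transport` carries its outcome back to `c`.
  five-colouring c = transport (decidable-stable (split? (lookup s)) λ ¬q →
      toWitnessFalse {a? = anySubset? λ s → ¬? (split? (lookup s))} _ (s , ¬q))
    where
    s : Subset 5
    s = tabulate c

    split? : (c : Fin 5 → Bool) → Dec (Monochromatic c ⊎ MinorityPoint c)
    split? c =
      (all? λ i → all? λ j → c i Bool.≟ c j) ⊎-dec
      (any? λ i → any? λ j → any? λ k → any? λ l →
        (¬? (i Fin.≟ j) ×-dec ¬? (i Fin.≟ k) ×-dec ¬? (j Fin.≟ k)) ×-dec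
        ((c i Bool.≟ c j) ×-dec (c i Bool.≟ c k) ×-dec ¬? (c i Bool.≟ c l)))

    ≗ : ∀ i → lookup s i ≡ c i
    ≗ = lookup∘tabulate c

    transport : Monochromatic (lookup s) ⊎ MinorityPoint (lookup s) → Monochromatic c ⊎ MinorityPoint c
    transport (inj₁ mono) = inj₁ λ i j → ≡.subst₂ _≡_ (≗ i) (≗ j) (mono i j)
    transport (inj₂ (i , j , k , l , apart , ij , ik , il)) =
      inj₂ (i , j , k , l , apart ,
            ≡.subst₂ _≡_ (≗ i) (≗ j) ij , ≡.subst₂ _≡_ (≗ i) (≗ k) ik , ≡.subst₂ _≢_ (≗ i) (≗ l) il)

-- Comparison of 3ᵐ with the square of a fixed fraction of 2ᵐ.

module Growth where
  open import Data.Nat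
  open import Data.Nat.Properties
  open import Data.Nat.Solver using (module +-*-Solver)
  open import Relation.Binary.PropositionalEquality using (refl; sym; cong)
  open ≤-Reasoning
  open +-*-Solver

  -- From m to m + 1 the right side grows by the factor 4 and the left by 3(4 + m)/(3 + m), which is
  -- at most 4; the offset 3 is the least for which this holds already at m = 0.
  3^m-vs-4^m : ∀ m → (3 + m) * 3 ^ m ≤ 3 * (2 ^ m * 2 ^ m)
  3^m-vs-4^m zero    = ≤-refl
  3^m-vs-4^m (suc m) = begin
    (4 + m) * (3 * 3 ^ m)        ≡⟨ *-assoc (4 + m) 3 (3 ^ m) ⟨
    (4 + m) * 3 * 3 ^ m          ≤⟨ *-monoˡ-≤ (3 ^ m) step ⟩
    4 * (3 + m) * 3 ^ m          ≡⟨ *-assoc 4 (3 + m) (3 ^ m) ⟩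
    4 * ((3 + m) * 3 ^ m)        ≤⟨ *-monoʳ-≤ 4 (3^m-vs-4^m m) ⟩
    4 * (3 * (2 ^ m * 2 ^ m))    ≡⟨ solve 1 (λ x →
      con 4 :* (con 3 :* (x :* x)) := con 3 :* ((con 2 :* x) :* (con 2 :* x))) refl (2 ^ m) ⟩
    3 * (2 ^ suc m * 2 ^ suc m)  ∎
    where
    step : (4 + m) * 3 ≤ 4 * (3 + m)
    step = ≤-trans (m≤m+n _ m) (≤-reflexive (solve 1 (λ m →
      (con 4 :+ m) :* con 3 :+ m := con 4 :* (con 3 :+ m)) refl m))

  dyadic-bracket : ∀ n → 1 ≤ n → ∃ λ m → n ≤ 2 ^ m × 2 ^ m ≤ 2 * n
  dyadic-bracket (suc zero)    _ = 0 , ≤-refl , s≤s z≤n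
  dyadic-bracket (suc (suc n)) _ with dyadic-bracket (suc n) (s≤s z≤n)
  ... | m , lo , hi with suc (suc n) ≤? 2 ^ m
  ...   | yes lo′ = m , lo′ , ≤-trans hi (*-monoʳ-≤ 2 (n≤1+n (suc n)))
  ...   | no  gt  = suc m , lo′ , *-monoʳ-≤ 2 (<⇒≤ (≰⇒> gt))
    where
    lo′ : suc (suc n) ≤ 2 ^ suc m
    lo′ = begin
      suc (suc n)          ≤⟨ s≤s lo ⟩
      1 + 2 ^ m            ≤⟨ +-monoˡ-≤ (2 ^ m) (m^n>0 2 m) ⟩
      2 ^ m + 2 ^ m        ≡⟨ cong (λ x → 2 ^ m + x) (+-identityʳ _) ⟨
      2 ^ suc m            ∎

  -- If n < k s and h = ⌊s/2⌋ ≥ 1, then n < 3kh and 3·4ᵐ ≤ 12n² < 108k²h², while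
  -- (3 + m)·3ᵐ ≤ 3·4ᵐ; so m ≥ 108k² forces h² > 3ᵐ.
  threshold : ℕ → ℕ
  threshold k = k + 2 ^ (108 * (k * k))

  s≤1+2⌊s/2⌋ : ∀ s → s ≤ suc (2 * ⌊ s /2⌋)
  s≤1+2⌊s/2⌋ zero          = z≤n
  s≤1+2⌊s/2⌋ (suc zero)    = s≤s z≤n
  s≤1+2⌊s/2⌋ (suc (suc s)) = s≤s (≤-trans (s≤s (s≤1+2⌊s/2⌋ s)) (≤-reflexive (sym (*-suc 2 ⌊ s /2⌋))))

  half-square-exceeds : ∀ k m n s → 1 ≤ k → threshold k ≤ n → n ≤ 2 ^ m → 2 ^ m ≤ 2 * n →
                        n < k * s → 3 ^ m < ⌊ s /2⌋ * ⌊ s /2⌋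
  half-square-exceeds k m n s k≥1 n≥N lo hi n<ks with ⌊ s /2⌋ | s≤1+2⌊s/2⌋ s
  -- Here s ≤ 1, and the summand k of `threshold` excludes n < k s.
  ... | zero | s≤1 = contradiction n<ks (≤⇒≯ (begin
    k * s         ≤⟨ *-monoʳ-≤ k s≤1 ⟩
    k * 1         ≡⟨ *-identityʳ k ⟩
    k             ≤⟨ m≤m+n k _ ⟩
    threshold k   ≤⟨ n≥N ⟩
    n             ∎))
  ... | h@(suc h′) | s≤1+2h = *-cancelˡ-< (108 * (k * k)) (3 ^ m) (h * h) (begin-strict
    108 * (k * k) * 3 ^ m                 ≤⟨ *-monoˡ-≤ (3 ^ m) (≤-trans m-large (m≤n+m m 3)) ⟩
    (3 + m) * 3 ^ m                       ≤⟨ 3^m-vs-4^m m ⟩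
    3 * (2 ^ m * 2 ^ m)                   ≤⟨ *-monoʳ-≤ 3 (*-mono-≤ hi hi) ⟩
    3 * ((2 * n) * (2 * n))               ≡⟨ solve 1 (λ n →
      con 3 :* ((con 2 :* n) :* (con 2 :* n)) := con 12 :* (n :* n)) refl n ⟩
    12 * (n * n)                          <⟨ *-monoʳ-< 12 (*-mono-< n<3kh n<3kh) ⟩
    12 * (k * (3 * h) * (k * (3 * h)))    ≡⟨ solve 2 (λ k h →
      con 12 :* (k :* (con 3 :* h) :* (k :* (con 3 :* h))) := con 108 :* (k :* k) :* (h :* h)) refl k h ⟩
    108 * (k * k) * (h * h)               ∎)
    where
    n<3kh : n < k * (3 * h)
    n<3kh = <-≤-trans n<ks (*-monoʳ-≤ k (≤-trans s≤1+2h (+-monoˡ-≤ (2 * h) (s≤s (z≤n {h′})))))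
    m-large : 108 * (k * k) ≤ m
    m-large = ≮⇒≥ λ m<M → <⇒≱ (^-monoʳ-< 2 (s≤s (s≤s z≤n)) m<M) (≤-trans (m≤n+m _ k) (≤-trans n≥N lo))

-- Vertices of the cube and coincidences among their pairwise sums.

bits : ∀ m → Fin (2 ℕ.^ m) → Cube m
bits zero    _ = []
bits (suc m) i = let b , j = remQuot {2} (2 ℕ.^ m) i in Inverse.to 2↔Bool b ∷ bits m j

bits-injective : ∀ m i j → bits m i ≡ bits m j → i ≡ j
bits-injective zero    0F 0F _  = ≡.refl
bits-injective (suc m) i  j  eq =
  let b≡ , js≡ = ∷-injective eq
  in begin
    i                                             ≡⟨ combine-remQuot {2} (2 ℕ.^ m) i ⟨
    uncurry combine (remQuot {2} (2 ℕ.^ m) i)     ≡⟨ ≡.cong₂ combine (Injection.injective (↔⇒↣ 2↔Bool) b≡) (bits-injective m _ _ js≡) ⟩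
    uncurry combine (remQuot {2} (2 ℕ.^ m) j)     ≡⟨ combine-remQuot {2} (2 ℕ.^ m) j ⟩
    j                                             ∎
  where open ≡.≡-Reasoning

digit : Bool → Bool → Fin 3
digit false false = 0F
digit false true  = 1F
digit true  false = 1F
digit true  true  = 2F

-- The vector sum x + y ∈ {0,1,2}ᵐ, read in base 3.
sumCode : ∀ {m} → Cube m → Cube m → Fin (3 ℕ.^ m)
sumCode []      []      = zero
sumCode (a ∷ x) (b ∷ y) = combine (digit a b) (sumCode x y)

digit-cancelˡ : ∀ a b c → digit a b ≡ digit a c → b ≡ c
digit-cancelˡ false false false _ = ≡.refl
digit-cancelˡ false true  true  _ = ≡.refl
digit-cancelˡ true  false false _ = ≡.refl
digit-cancelˡ true  true  true  _ = ≡.refl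

digit-comm : ∀ a b → digit a b ≡ digit b a
digit-comm false false = ≡.refl
digit-comm false true  = ≡.refl
digit-comm true  false = ≡.refl
digit-comm true  true  = ≡.refl

-- A digit determines the unordered pair of its summands. Hence equal codes give equal sums of the
-- projected points, coordinate by coordinate, using only commutativity of addition.
digit-≡⇒ : ∀ a b c d → digit a b ≡ digit c d → (a ≡ c × b ≡ d) ⊎ (a ≡ d × b ≡ c)
digit-≡⇒ false false false false _ = inj₁ (≡.refl , ≡.refl)
digit-≡⇒ false false false true  ()
digit-≡⇒ false false true  true  ()
digit-≡⇒ true  true  false false ()
digit-≡⇒ true  true  true  false ()
digit-≡⇒ false true  false true  _ = inj₁ (≡.refl , ≡.refl)
digit-≡⇒ false true  true  false _ = inj₂ (≡.refl , ≡.refl)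
digit-≡⇒ true  false false true  _ = inj₂ (≡.refl , ≡.refl)
digit-≡⇒ true  false true  false _ = inj₁ (≡.refl , ≡.refl)
digit-≡⇒ true  true  true  true  _ = inj₁ (≡.refl , ≡.refl)

sumCode-comm : ∀ {m} (x y : Cube m) → sumCode x y ≡ sumCode y x
sumCode-comm []      []      = ≡.refl
sumCode-comm (a ∷ x) (b ∷ y) = ≡.cong₂ combine (digit-comm a b) (sumCode-comm x y)

sumCode-cancelˡ : ∀ {m} (x y z : Cube m) → sumCode x y ≡ sumCode x z → y ≡ z
sumCode-cancelˡ []      []      []      _  = ≡.refl
sumCode-cancelˡ (a ∷ x) (b ∷ y) (c ∷ z) eq =
  let d≡ , s≡ = combine-injective _ (sumCode x y) _ (sumCode x z) eq
  in ≡.cong₂ _∷_ (digit-cancelˡ a b c d≡) (sumCode-cancelˡ x y z s≡)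

sumCode-cancelʳ : ∀ {m} (x y z : Cube m) → sumCode y x ≡ sumCode z x → y ≡ z
sumCode-cancelʳ x y z eq =
  sumCode-cancelˡ x y z (≡.trans (sumCode-comm x y) (≡.trans eq (sumCode-comm z x)))

↑ˡ≢↑ʳ : ∀ {m n} (i : Fin m) (j : Fin n) → i ↑ˡ n ≢ m ↑ʳ j
↑ˡ≢↑ʳ {m} {n} i j eq
  with () ← ≡.trans (≡.sym (splitAt-↑ˡ m i n)) (≡.trans (≡.cong (Fin.splitAt m) eq) (splitAt-↑ʳ m n j))

-- Taking the two summands from disjoint halves of the index set rules out
-- both degenerate sums x + x and the trivial coincidence x + y = y + x.
equal-sums : ∀ {m} h (f : Fin (h ℕ.+ h) → Cube m) → (∀ i j → f i ≡ f j → i ≡ j) →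
  3 ℕ.^ m ℕ.< h ℕ.* h →
  ∃ λ x → ∃ λ y → ∃ λ z → ∃ λ w → Unique (x ∷ y ∷ z ∷ w ∷ []) × sumCode (f x) (f y) ≡ sumCode (f z) (f w)
equal-sums {m} h f inj 3^m<h²
  with s , t , s<t , eq ← pigeonhole 3^m<h² (λ s → let i , j = remQuot {h} h s in sumCode (f (i ↑ˡ h)) (f (h ↑ʳ j))) =
  let i , j = remQuot {h} h s
      k , l = remQuot {h} h t
      s≢t : ¬ (i ≡ k × j ≡ l)
      s≢t (i≡k , j≡l) = Fin.<⇒≢ s<t (begin
        s                            ≡⟨ combine-remQuot {h} h s ⟨
        combine i j                  ≡⟨ ≡.cong₂ combine i≡k j≡l ⟩
        combine k l                  ≡⟨ combine-remQuot {h} h t ⟩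
        t                            ∎)
      x = i ↑ˡ h ; y = h ↑ʳ j ; z = k ↑ˡ h ; w = h ↑ʳ l
      -- By cancellation, agreement in one half of the index set forces agreement in the other,
      -- hence s = t. The four crosswise equalities fail because the halves are disjoint.
      y≡w : x ≡ z → y ≡ w
      y≡w x≡z = inj y w (sumCode-cancelˡ (f x) _ _ (≡.trans eq (≡.cong (λ u → sumCode (f u) (f w)) (≡.sym x≡z))))
      x≡z : y ≡ w → x ≡ z
      x≡z y≡w = inj x z (sumCode-cancelʳ (f y) _ _ (≡.trans eq (≡.cong (λ u → sumCode (f z) (f u)) (≡.sym y≡w))))
      both : x ≡ z → y ≡ w → i ≡ k × j ≡ l
      both p q = ↑ˡ-injective h i k p , ↑ʳ-injective h j l q
  in x , y , z , w ,
     ((↑ˡ≢↑ʳ i j ∷ (λ p → s≢t (both p (y≡w p))) ∷ ↑ˡ≢↑ʳ i l ∷ [])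
     ∷ ((↑ˡ≢↑ʳ k j ∘ ≡.sym) ∷ (λ q → s≢t (both (x≡z q) q)) ∷ [])
     ∷ (↑ˡ≢↑ʳ k l ∷ []) ∷ [] ∷ []) , eq
  where open ≡.≡-Reasoning

member : ∀ {n} (S : Subset n) → Fin ∣ S ∣ → Fin n
member (inside  ∷ S) zero    = zero
member (inside  ∷ S) (suc i) = suc (member S i)
member (outside ∷ S) i       = suc (member S i)

member-∈ : ∀ {n} (S : Subset n) i → member S i ∈ S
member-∈ (inside  ∷ S) zero    = here
member-∈ (inside  ∷ S) (suc i) = there (member-∈ S i)
member-∈ (outside ∷ S) i       = there (member-∈ S i)

member-injective : ∀ {n} (S : Subset n) i j → member S i ≡ member S j → i ≡ j
member-injective (inside  ∷ S) zero    zero    _  = ≡.refl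
member-injective (inside  ∷ S) (suc i) (suc j) eq = ≡.cong suc (member-injective S i j (Fin.suc-injective eq))
member-injective (outside ∷ S) i       j       eq = member-injective S i j (Fin.suc-injective eq)

⌊n/2⌋+⌊n/2⌋≤n : ∀ n → ⌊ n /2⌋ ℕ.+ ⌊ n /2⌋ ℕ.≤ n
⌊n/2⌋+⌊n/2⌋≤n n = ℕ.≤-trans (ℕ.+-monoʳ-≤ ⌊ n /2⌋ (ℕ.⌊n/2⌋≤⌈n/2⌉ n)) (ℕ.≤-reflexive (ℕ.⌊n/2⌋+⌈n/2⌉≡n n))

-- If ∣ S ∣ is odd, its last element is dropped, so that the index set has the two equal halves that
-- `equal-sums` works with.
halfMember : ∀ {n} (S : Subset n) → Fin (⌊ ∣ S ∣ /2⌋ ℕ.+ ⌊ ∣ S ∣ /2⌋) → Fin n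
halfMember S i = member S (inject≤ i (⌊n/2⌋+⌊n/2⌋≤n ∣ S ∣))

halfMember-injective : ∀ {n} (S : Subset n) i j → halfMember S i ≡ halfMember S j → i ≡ j
halfMember-injective S i j = inject≤-injective half half i j ∘ member-injective S _ _
  where half = ⌊n/2⌋+⌊n/2⌋≤n ∣ S ∣

-- Vector algebra in ℝ³.

module Construction (ℝ : RealField) where
  open RealField ℝ hiding (zero)
  open Geometry3 ℝ
  open IntegerCoefficients field′ using (⟦⟧-homo; ⟦⟧≟)
  open Algebra.Solver.Ring ℤ.+-*-rawRing (fromCommutativeRing field′) ⟦⟧-homo ⟦⟧≟
    using (Polynomial; var; con; prove; solve; _:=_; _:+_; _:*_; _:-_; :-_)
  open import Algebra.Properties.CommutativeSemigroup +-commutativeSemigroup using (interchange)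
  open import Algebra.Properties.Group +-group using (∙-cancelˡ; x∙y⁻¹≈ε⇒x≈y; x≈y⇒x∙y⁻¹≈ε)
  open import Algebra.Properties.Ring ring using (-0#≈0#)
  module ≈-Reasoning = Relation.Binary.Reasoning.Setoid setoid

  -- Trichotomy makes equality decidable; this justifies the later case distinctions on vanishing
  -- normals and the proofs by contradiction.
  ≈-dec : ∀ x y → Dec (x ≈ y)
  ≈-dec x y with <-tri x y
  ... | inj₁ x<y        = no λ x≈y → <-irrefl (<-resp-≈ x≈y refl x<y)
  ... | inj₂ (inj₁ x≈y) = yes x≈y
  ... | inj₂ (inj₂ y<x) = no λ x≈y → <-irrefl (<-resp-≈ refl x≈y y<x)

  cancelʳ : ∀ {x y} → ¬ y ≈ 0# → x * y ≈ 0# → x ≈ 0#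
  cancelʳ {x} {y} y≉0 xy≈0 with y⁻¹ , yy⁻¹≈1 ← inverse y y≉0 = begin
    x               ≈⟨ *-identityʳ x ⟨
    x * 1#          ≈⟨ *-congˡ yy⁻¹≈1 ⟨
    x * (y * y⁻¹)   ≈⟨ *-assoc x y y⁻¹ ⟨
    (x * y) * y⁻¹   ≈⟨ *-congʳ xy≈0 ⟩
    0# * y⁻¹        ≈⟨ zeroˡ y⁻¹ ⟩
    0#              ∎
    where open ≈-Reasoning

  *-zero : ∀ {x y} → y ≈ 0# → x * y ≈ 0#
  *-zero {x} e = trans (*-congˡ e) (zeroʳ x)

  -- Records rather than function types, so that the points can be inferred.
  infix 4 _≋_
  record _≋_ (p q : Point) : Set where
    constructor pointwise
    field at : ∀ i → p i ≈ q i

  ≋-refl : ∀ {p} → p ≋ p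
  ≋-refl = pointwise λ i → refl

  record Zero (p : Point) : Set where
    constructor vanishing
    field vanishes : ∀ i → p i ≈ 0#
  open Zero

  zero? : ∀ p → Dec (Zero p)
  zero? p = map′ vanishing vanishes (all? λ i → ≈-dec (p i) 0#)

  point : Carrier → Carrier → Carrier → Point
  point a b c 0F = a
  point a b c 1F = b
  point a b c 2F = c

  infixl 6 _⊕_ _⊝_
  infixl 7 _⨯_
  _⊕_ _⊝_ _⨯_ : Point → Point → Point
  (p ⊕ q) i = p i + q i
  (p ⊝ q) i = p i - q i
  (p ⨯ q) 0F = p 1F * q 2F - p 2F * q 1F
  (p ⨯ q) 1F = p 2F * q 0F - p 0F * q 2F
  (p ⨯ q) 2F = p 0F * q 1F - p 1F * q 0F

  ·-congˡ : ∀ n {p q} → p ≋ q → n · p ≈ n · q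
  ·-congˡ n (pointwise e) = +-cong (*-congˡ (e 0F)) (+-cong (*-congˡ (e 1F)) (*-congˡ (e 2F)))

  ·-zeroʳ : ∀ p {q} → Zero q → p · q ≈ 0#
  ·-zeroʳ p (vanishing z) =
    trans (+-cong (*-zero (z 0F)) (trans (+-cong (*-zero (z 1F)) (*-zero (z 2F))) (+-identityˡ 0#)))
          (+-identityˡ 0#)

  ⨯-cong : ∀ {p p′ q q′} → p ≋ p′ → q ≋ q′ → (p ⨯ q) ≋ (p′ ⨯ q′)
  ⨯-cong (pointwise e) (pointwise f) = pointwise λ
    { 0F → minor (e 1F) (f 2F) (e 2F) (f 1F)
    ; 1F → minor (e 2F) (f 0F) (e 0F) (f 2F)
    ; 2F → minor (e 0F) (f 1F) (e 1F) (f 0F) }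
    where
    minor : ∀ {a a′ b b′ c c′ d d′} → a ≈ a′ → b ≈ b′ → c ≈ c′ → d ≈ d′ → a * b - c * d ≈ a′ * b′ - c′ * d′
    minor a b c d = +-cong (*-cong a b) (-‿cong (*-cong c d))

  Zero-resp : ∀ {p q} → p ≋ q → Zero p → Zero q
  Zero-resp (pointwise e) (vanishing z) = vanishing λ i → trans (sym (e i)) (z i)

  -- Symbolic vectors, so that vector identities can be given to the ring solver
  -- coordinate-free: 𝕩 j is the j-th vector of the list passed to coords.
  Triple : ℕ → Set
  Triple k = Fin 3 → Polynomial k

  infixl 6 _⊕ₚ_ _⊝ₚ_
  infixl 7 _⨯ₚ_
  infix  8 _·ₚ_
  _·ₚ_ : ∀ {k} → Triple k → Triple k → Polynomial k
  p ·ₚ q = p 0F :* q 0F :+ (p 1F :* q 1F :+ p 2F :* q 2F)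

  _⊕ₚ_ _⊝ₚ_ _⨯ₚ_ : ∀ {k} → Triple k → Triple k → Triple k
  (p ⊕ₚ q) i = p i :+ q i
  (p ⊝ₚ q) i = p i :- q i
  (p ⨯ₚ q) 0F = p 1F :* q 2F :- p 2F :* q 1F
  (p ⨯ₚ q) 1F = p 2F :* q 0F :- p 0F :* q 2F
  (p ⨯ₚ q) 2F = p 0F :* q 1F :- p 1F :* q 0F

  -- Unlike k * 3, thrice k determines k by unification.
  thrice : ℕ → ℕ
  thrice zero    = zero
  thrice (suc k) = suc (suc (suc (thrice k)))

  coordinate : ∀ {k} → Fin k → Fin 3 → Fin (thrice k)
  coordinate zero    0F = 0F
  coordinate zero    1F = 1F
  coordinate zero    2F = 2F
  coordinate (suc j) i  = suc (suc (suc (coordinate j i)))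

  𝕩 : ∀ {k} → Fin k → Triple (thrice k)
  𝕩 j i = var (coordinate j i)

  coords : ∀ {k} → Vec Point k → Vec Carrier (thrice k)
  coords []       = []
  coords (p ∷ ps) = p 0F ∷ p 1F ∷ p 2F ∷ coords ps

  ·-⊕ : ∀ n p q → n · (p ⊕ q) ≈ n · p + n · q
  ·-⊕ n p q = prove (coords (n ∷ p ∷ q ∷ []))
    (𝕩 0F ·ₚ (𝕩 1F ⊕ₚ 𝕩 2F)) ((𝕩 0F ·ₚ 𝕩 1F) :+ (𝕩 0F ·ₚ 𝕩 2F)) refl

  ·-⊝ : ∀ n p q → n · (p ⊝ q) ≈ n · p - n · q
  ·-⊝ n p q = prove (coords (n ∷ p ∷ q ∷ []))
    (𝕩 0F ·ₚ (𝕩 1F ⊝ₚ 𝕩 2F)) ((𝕩 0F ·ₚ 𝕩 1F) :- (𝕩 0F ·ₚ 𝕩 2F)) refl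

  triple-product : ∀ u v w → u · (v ⨯ w) ≈ (u ⨯ v) · w
  triple-product u v w = prove (coords (u ∷ v ∷ w ∷ []))
    (𝕩 0F ·ₚ (𝕩 1F ⨯ₚ 𝕩 2F)) ((𝕩 0F ⨯ₚ 𝕩 1F) ·ₚ 𝕩 2F) refl

  ⨯-orthogonalˡ : ∀ u v → (u ⨯ v) · u ≈ 0#
  ⨯-orthogonalˡ u v = prove (coords (u ∷ v ∷ [])) ((𝕩 0F ⨯ₚ 𝕩 1F) ·ₚ 𝕩 0F) (con ℤ.0ℤ) refl

  ⨯-orthogonalʳ : ∀ u v → (u ⨯ v) · v ≈ 0#
  ⨯-orthogonalʳ u v = prove (coords (u ∷ v ∷ [])) ((𝕩 0F ⨯ₚ 𝕩 1F) ·ₚ 𝕩 1F) (con ℤ.0ℤ) refl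

  ⨯-swap-zero : ∀ {p q} → Zero (p ⨯ q) → Zero (q ⨯ p)
  ⨯-swap-zero {p} {q} (vanishing z) =
    vanishing λ i → trans (anticommute i) (trans (-‿cong (z i)) -0#≈0#)
    where
    ρ = coords (p ∷ q ∷ [])
    swap : Fin 3 → Polynomial 6 × Polynomial 6
    swap i = (𝕩 1F ⨯ₚ 𝕩 0F) i , :- (𝕩 0F ⨯ₚ 𝕩 1F) i
    anticommute : ∀ i → (q ⨯ p) i ≈ - (p ⨯ q) i
    -- The coordinate is matched first because the solver's `refl` only computes at a concrete
    -- coordinate.
    anticommute 0F = uncurry (prove ρ) (swap 0F) refl
    anticommute 1F = uncurry (prove ρ) (swap 1F) refl
    anticommute 2F = uncurry (prove ρ) (swap 2F) refl

  -- Both sides are twice the oriented area vector of the triangle p q r, which is unchanged by a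
  -- cyclic change of base vertex.
  ⨯-rotate : ∀ p q r → ((q ⊝ p) ⨯ (r ⊝ p)) ≋ ((r ⊝ q) ⨯ (p ⊝ q))
  ⨯-rotate p q r = pointwise λ
    { 0F → uncurry (prove ρ) (rotate 0F) refl
    ; 1F → uncurry (prove ρ) (rotate 1F) refl
    ; 2F → uncurry (prove ρ) (rotate 2F) refl }
    where
    ρ = coords (p ∷ q ∷ r ∷ [])
    rotate : Fin 3 → Polynomial 9 × Polynomial 9
    rotate i = ((𝕩 1F ⊝ₚ 𝕩 0F) ⨯ₚ (𝕩 2F ⊝ₚ 𝕩 0F)) i , ((𝕩 2F ⊝ₚ 𝕩 1F) ⨯ₚ (𝕩 0F ⊝ₚ 𝕩 1F)) i

  basis : Fin 3 → Point
  basis 0F = point 1# 0# 0#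
  basis 1F = point 0# 1# 0#
  basis 2F = point 0# 0# 1#

  -- Read contrapositively: a nonzero vector is not parallel to every basis vector. This turns the
  -- nonvanishing of a cross product into the avoidance of a single plane.
  basis⨯-zero : ∀ {u} → (∀ i → Zero (basis i ⨯ u)) → Zero u
  basis⨯-zero z = vanishing λ
    { 0F → go (vanishes (z 2F) 1F) ; 1F → go (vanishes (z 0F) 2F) ; 2F → go (vanishes (z 1F) 0F) }
    where
    open ≈-Reasoning
    go : ∀ {x y} → 1# * x - 0# * y ≈ 0# → x ≈ 0#
    go {x} {y} e = begin
      x                 ≈⟨ *-identityˡ x ⟨
      1# * x            ≈⟨ solve 2 (λ s t → s := (s :- t) :+ t) refl (1# * x) (0# * y) ⟩
      (1# * x - 0# * y) + 0# * y  ≈⟨ +-cong e (zeroˡ y) ⟩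
      0# + 0#           ≈⟨ +-identityˡ 0# ⟩
      0#                ∎

  basis-nonzero : ∀ i → ¬ Zero (basis i)
  basis-nonzero 0F (vanishing z) = <-irrefl (<-resp-≈ refl (z 0F) 0<1)
  basis-nonzero 1F (vanishing z) = <-irrefl (<-resp-≈ refl (z 1F) 0<1)
  basis-nonzero 2F (vanishing z) = <-irrefl (<-resp-≈ refl (z 2F) 0<1)

  -- Cramer's rule for the linear system with unknown n.
  orthogonal⇒det≈0 : ∀ {n} → ¬ Zero n → ∀ u v w → n · u ≈ 0# → n · v ≈ 0# → n · w ≈ 0# →
                     (u ⨯ v) · w ≈ 0#
  orthogonal⇒det≈0 {n} n≠0 u v w nu nv nw =
    decidable-stable (≈-dec _ _) λ d≉0 → n≠0 (vanishing λ i → cancelʳ d≉0 (component i))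
    where
    open ≈-Reasoning
    expand : ∀ i → n i * ((u ⨯ v) · w) ≈ (v ⨯ w) i * (n · u) + ((w ⨯ u) i * (n · v) + (u ⨯ v) i * (n · w))
    expand = λ
      { 0F → uncurry (prove ρ) (cramer 0F) refl
      ; 1F → uncurry (prove ρ) (cramer 1F) refl
      ; 2F → uncurry (prove ρ) (cramer 2F) refl }
      where
      ρ = coords (n ∷ u ∷ v ∷ w ∷ [])
      cramer : Fin 3 → Polynomial 12 × Polynomial 12
      cramer i =
        𝕩 0F i :* ((𝕩 1F ⨯ₚ 𝕩 2F) ·ₚ 𝕩 3F) ,
        (𝕩 2F ⨯ₚ 𝕩 3F) i :* (𝕩 0F ·ₚ 𝕩 1F)
          :+ ((𝕩 3F ⨯ₚ 𝕩 1F) i :* (𝕩 0F ·ₚ 𝕩 2F) :+ (𝕩 1F ⨯ₚ 𝕩 2F) i :* (𝕩 0F ·ₚ 𝕩 3F))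
    component : ∀ i → n i * ((u ⨯ v) · w) ≈ 0#
    component i = begin
      n i * ((u ⨯ v) · w)   ≈⟨ expand i ⟩
      (v ⨯ w) i * (n · u) + ((w ⨯ u) i * (n · v) + (u ⨯ v) i * (n · w))
        ≈⟨ +-cong (*-zero nu) (+-cong (*-zero nv) (*-zero nw)) ⟩
      0# + (0# + 0#)        ≈⟨ trans (+-identityˡ _) (+-identityˡ _) ⟩
      0#                    ∎

  -- Generic points of ℝ³.

  Eventually : (Carrier → Set) → Set
  Eventually φ = Σ Carrier λ T → ∀ t → T < t → φ t

  eventually-map : ∀ {φ ψ} → (∀ t → φ t → ψ t) → Eventually φ → Eventually ψ
  eventually-map f (T , h) = T , λ t T<t → f t (h t T<t)

  eventually-always : ∀ {φ} → (∀ t → φ t) → Eventually φ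
  eventually-always h = 0# , λ t _ → h t

  eventually-× : ∀ {φ ψ} → Eventually φ → Eventually ψ → Eventually λ t → φ t × ψ t
  eventually-× (T , h) (U , k) with <-tri T U
  ... | inj₁ T<U        = U , λ t U<t → h t (<-trans T<U U<t) , k t U<t
  ... | inj₂ (inj₁ T≈U) = U , λ t U<t → h t (<-resp-≈ (sym T≈U) refl U<t) , k t U<t
  ... | inj₂ (inj₂ U<T) = T , λ t T<t → h t T<t , k t (<-trans U<T T<t)

  eventually-witness : ∀ {φ} → Eventually φ → ∃ φ
  eventually-witness (T , h) = 1# + T , h _ (<-resp-≈ (+-identityˡ T) refl (+-mono-< T 0<1))

  -- The only solution (e - k)/x serves itself as the bound: nothing strictly beyond it can equal
  -- it.
  eventually-≉ : ∀ {x} → ¬ x ≈ 0# → ∀ k e → Eventually λ t → ¬ k + x * t ≈ e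
  eventually-≉ {x} x≉0 k e with y , xy≈1 ← inverse x x≉0 =
    (e - k) * y , λ t T<t eq → <-irrefl (<-resp-≈ refl (t≈ t eq) T<t)
    where
    open ≈-Reasoning
    t≈ : ∀ t → k + x * t ≈ e → t ≈ (e - k) * y
    t≈ t eq = begin
      t                        ≈⟨ *-identityˡ t ⟨
      1# * t                   ≈⟨ *-congʳ xy≈1 ⟨
      (x * y) * t              ≈⟨ solve 4 (λ k x y t → (x :* y) :* t := ((k :+ x :* t) :- k) :* y) refl k x y t ⟩
      ((k + x * t) - k) * y    ≈⟨ *-congʳ (+-congʳ eq) ⟩
      (e - k) * y              ∎

  -- The coordinates are chosen one after the other, so that a plane is
  -- avoided by avoiding a single value of the last relevant coordinate.
  record Generic (φ : Point → Set) : Set where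
    constructor generic
    field holds : Eventually λ a → Eventually λ b → Eventually λ c → φ (point a b c)

  generic-map : ∀ {φ ψ} → (∀ v → φ v → ψ v) → Generic φ → Generic ψ
  generic-map f (generic g) = generic
    (eventually-map (λ a → eventually-map λ b → eventually-map λ c → f (point a b c)) g)

  generic-always : ∀ {φ} → (∀ v → φ v) → Generic φ
  generic-always h = generic
    (eventually-always λ a → eventually-always λ b → eventually-always λ c → h (point a b c))

  generic-× : ∀ {φ ψ} → Generic φ → Generic ψ → Generic λ v → φ v × ψ v
  generic-× (generic g) (generic h) = generic
    (eventually-map (λ a (g , h) →
      eventually-map (λ b (g , h) → eventually-× g h) (eventually-× g h)) (eventually-× g h))

  generic-witness : ∀ {φ} → Generic φ → ∃ φ
  generic-witness (generic g) =
    let a , g = eventually-witness g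
        b , g = eventually-witness g
        c , h = eventually-witness g
    in point a b c , h

  -- The bounds must be chosen before the premise is known to hold. The premises in question, such
  -- as a nonzero normal, do not involve v and can be decided beforehand.
  generic-→ : ∀ {P : Set} {φ} → Dec P → (P → Generic φ) → Generic λ v → P → φ v
  generic-→ (yes p) g = generic-map (λ v h _ → h) (g p)
  generic-→ (no ¬p) g = generic-always λ v p → contradiction p ¬p

  generic-∀Fin : ∀ {n} {φ : Fin n → Point → Set} → (∀ i → Generic (φ i)) → Generic λ v → ∀ i → φ i v
  generic-∀Fin {zero}  g = generic-always λ v ()
  generic-∀Fin {suc n} g = generic-map (λ { v (h , hs) zero → h ; v (h , hs) (suc i) → hs i })
    (generic-× (g zero) (generic-∀Fin (g ∘ suc)))

  generic-∀ : ∀ {m} {φ : Cube m → Point → Set} → (∀ x → Generic (φ x)) → Generic λ v → ∀ x → φ x v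
  generic-∀ {zero}  g = generic-map (λ { v h [] → h }) (g [])
  generic-∀ {suc m} g = generic-map (λ { v (h , k) (true ∷ x) → h x ; v (h , k) (false ∷ x) → k x })
    (generic-× (generic-∀ (g ∘ (true ∷_))) (generic-∀ (g ∘ (false ∷_))))

  -- The split looks for the last nonzero coordinate of the normal; once the earlier coordinates of
  -- v are fixed, the plane allows one value there, and later coordinates do not matter.
  generic-off-plane : ∀ {n} → ¬ Zero n → ∀ e → Generic λ v → ¬ n · v ≈ e
  generic-off-plane {n} n≠0 e with ≈-dec (n 2F) 0# | ≈-dec (n 1F) 0# | ≈-dec (n 0F) 0#
  ... | no n₂≉0 | _ | _ = generic
    (eventually-always λ a → eventually-always λ b →
      eventually-map (λ c h eq → h (trans (+-assoc _ _ _) eq)) (eventually-≉ n₂≉0 (n 0F * a + n 1F * b) e))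
  ... | yes n₂≈0 | no n₁≉0 | _ = generic
    (eventually-always λ a →
      eventually-map (λ b h → eventually-always λ c eq → h (trans (+-congˡ (sym (drop-last n₂≈0))) eq))
        (eventually-≉ n₁≉0 (n 0F * a) e))
    where
    drop-last : ∀ {x y z} → y ≈ 0# → x + y * z ≈ x
    drop-last {z = z} y≈0 = trans (+-congˡ (trans (*-congʳ y≈0) (zeroˡ z))) (+-identityʳ _)
  ... | yes n₂≈0 | yes n₁≈0 | no n₀≉0 = generic
    (eventually-map (λ a h → eventually-always λ b → eventually-always λ c eq →
        h (trans (drop-first n₁≈0 n₂≈0) eq))
      (eventually-≉ n₀≉0 0# e))
    where
    drop-first : ∀ {w x y z t} → x ≈ 0# → z ≈ 0# → 0# + w ≈ w + (x * y + z * t)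
    drop-first {y = y} {t = t} x≈0 z≈0 = trans (+-comm _ _) (+-congˡ (sym
      (trans (+-cong (trans (*-congʳ x≈0) (zeroˡ y)) (trans (*-congʳ z≈0) (zeroˡ t))) (+-identityˡ 0#))))
  ... | yes n₂≈0 | yes n₁≈0 | yes n₀≈0 =
    contradiction (vanishing λ { 0F → n₀≈0 ; 1F → n₁≈0 ; 2F → n₂≈0 }) n≠0

  -- Building the projection one vector at a time.

  place : ∀ {m} → Vec Point m → Cube m → Point
  place []       []          = λ _ → 0#
  place (v ∷ vs) (true  ∷ x) = v ⊕ place vs x
  place (v ∷ vs) (false ∷ x) = place vs x

  diff : ∀ {m} → Vec Point m → Cube m → Cube m → Point
  diff vs x y = place vs x ⊝ place vs y

  -- In `no-five` a plane is given by its normal alone: all differences of the five points are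
  -- orthogonal to it. The other two fields also make the normals of the planes to be avoided at the
  -- next step nonzero.
  record Scattered {m} (vs : Vec Point m) : Set where
    field
      distinct     : ∀ x y → x ≢ y → ¬ Zero (diff vs x y)
      noncollinear : ∀ x y z → x ≢ y → x ≢ z → y ≢ z → ¬ Zero (diff vs y x ⨯ diff vs z x)
      no-five      : ∀ n → ¬ Zero n → (g : Fin 5 → Cube m) → (∀ i j → g i ≡ g j → i ≡ j) →
                     ¬ (∀ i j → n · diff vs (g i) (g j) ≈ 0#)

  -- Five points of the doubled configuration either lie in one of the two translated
  -- copies, or three of them lie in one copy and some fourth one in the other.  So the
  -- new vector only has to keep each copy off the planes through three points of the other.
  record Transverse {m} (vs : Vec Point m) (w : Point) : Set where
    field
      off-points : ¬ Zero w
      off-lines  : ∀ x y → x ≢ y → ¬ Zero (diff vs y x ⨯ w)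
      off-planes : ∀ x y z → x ≢ y → x ≢ z → y ≢ z → ¬ (diff vs y x ⨯ diff vs z x) · w ≈ 0#

  -- Between the two copies v enters the difference with coefficient 1 or -1, so the condition keeps
  -- v off one plane with normal n.
  generic-diff : ∀ {m} (vs : Vec Point m) {n} → ¬ Zero n → ∀ x y → head x ≢ head y →
                 Generic λ v → ¬ n · diff (v ∷ vs) x y ≈ 0#
  generic-diff vs n≠0 (true  ∷ x) (true  ∷ y) h = contradiction ≡.refl h
  generic-diff vs n≠0 (false ∷ x) (false ∷ y) h = contradiction ≡.refl h
  generic-diff vs {n} n≠0 (true ∷ x) (false ∷ y) _ =
    generic-map (λ v off eq → off (rearrange v (place vs x) (place vs y) eq))
      (generic-off-plane n≠0 (n · (place vs y ⊝ place vs x)))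
    where
    rearrange : ∀ v p q → n · ((v ⊕ p) ⊝ q) ≈ 0# → n · v ≈ n · (q ⊝ p)
    rearrange v p q eq = trans
      (prove (coords (n ∷ v ∷ p ∷ q ∷ []))
        (𝕩 0F ·ₚ 𝕩 1F)
        ((𝕩 0F ·ₚ ((𝕩 1F ⊕ₚ 𝕩 2F) ⊝ₚ 𝕩 3F)) :+ (𝕩 0F ·ₚ (𝕩 3F ⊝ₚ 𝕩 2F))) refl)
      (trans (+-congʳ eq) (+-identityˡ _))
  generic-diff vs {n} n≠0 (false ∷ x) (true ∷ y) _ =
    generic-map (λ v off eq → off (rearrange v (place vs x) (place vs y) eq))
      (generic-off-plane n≠0 (n · (place vs x ⊝ place vs y)))
    where
    rearrange : ∀ v p q → n · (p ⊝ (v ⊕ q)) ≈ 0# → n · v ≈ n · (p ⊝ q)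
    rearrange v p q eq = trans (sym (trans (+-congʳ eq) (+-identityˡ _)))
      (prove (coords (n ∷ v ∷ p ∷ q ∷ []))
        ((𝕩 0F ·ₚ (𝕩 2F ⊝ₚ (𝕩 1F ⊕ₚ 𝕩 3F))) :+ (𝕩 0F ·ₚ 𝕩 1F))
        (𝕩 0F ·ₚ (𝕩 2F ⊝ₚ 𝕩 3F)) refl)

  generic-transverse : ∀ {m} {vs : Vec Point m} → Scattered vs →
    Generic λ v → ∀ x y → head x ≢ head y → Transverse vs (diff (v ∷ vs) x y)
  generic-transverse {m} {vs} sc =
    generic-∀ λ x → generic-∀ λ y → generic-→ (¬? (head x Bool.≟ head y)) λ hd →
      generic-map (λ v (a , b , c) → record
        -- A nonzero first coordinate is demanded, which is more than w ≠ 0 but has the shape of a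
        -- plane condition.
        { off-points = λ z → a (·-zeroʳ (basis 0F) z)
        -- For d = `diff vs q p` some basis vector e has e ⨯ d nonzero, and (e ⨯ d) · w = e · (d ⨯
        -- w) is kept nonzero.
        ; off-lines  = λ p q p≢q z → Scattered.distinct sc q p (p≢q ∘ ≡.sym)
            (basis⨯-zero λ i → decidable-stable (zero? _) λ nz →
              b p q i nz (trans (sym (triple-product (basis i) (diff vs q p) (diff (v ∷ vs) x y))) (·-zeroʳ (basis i) z)))
        ; off-planes = λ p q r p≢q p≢r q≢r → c p q r (Scattered.noncollinear sc p q r p≢q p≢r q≢r) })
      (generic-× (generic-diff vs (basis-nonzero 0F) x y hd)
      (generic-× (generic-∀ λ p → generic-∀ λ q → generic-∀Fin λ i →
                    generic-→ (¬? (zero? (basis i ⨯ diff vs q p))) λ nz → generic-diff vs nz x y hd)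
                 (generic-∀ λ p → generic-∀ λ q → generic-∀ λ r →
                    generic-→ (¬? (zero? (diff vs q p ⨯ diff vs r p))) λ nz → generic-diff vs nz x y hd)))

  diff-same-head : ∀ {m} v (vs : Vec Point m) x y → head x ≡ head y →
                   diff (v ∷ vs) x y ≋ diff vs (tail x) (tail y)
  diff-same-head v vs (false ∷ x) (false ∷ y) _ = ≋-refl
  diff-same-head v vs (true ∷ x)  (true ∷ y)  _ = pointwise λ i →
    solve 3 (λ v p q → (v :+ p) :- (v :+ q) := p :- q) refl (v i) (place vs x i) (place vs y i)

  tail-≢ : ∀ {m} {x y : Cube (suc m)} → head x ≡ head y → x ≢ y → tail x ≢ tail y
  tail-≢ {x = _ ∷ _} {_ ∷ _} ≡.refl x≢y ≡.refl = x≢y ≡.refl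

  scattered-∷ : ∀ {m} v {vs : Vec Point m} → Scattered vs →
    (∀ x y → head x ≢ head y → Transverse vs (diff (v ∷ vs) x y)) → Scattered (v ∷ vs)
  scattered-∷ {m} v {vs} sc tr = record
    { distinct = dist ; noncollinear = noncol ; no-five = no5 }
    where
    open Scattered sc
    same : ∀ x y → head x ≡ head y → diff (v ∷ vs) x y ≋ diff vs (tail x) (tail y)
    same = diff-same-head v vs

    dist : ∀ x y → x ≢ y → ¬ Zero (diff (v ∷ vs) x y)
    dist x y x≢y with head x Bool.≟ head y
    ... | yes h = distinct _ _ (tail-≢ h x≢y) ∘ Zero-resp (same x y h)
    ... | no h  = Transverse.off-points (tr x y h)

    -- The mixed case of noncollinearity in normal form, with the base vertex x in the same copy as
    -- y; the other arrangements are brought to it by swapping or rotating the triangle.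
    two-one : ∀ x y z → head x ≡ head y → head z ≢ head x → x ≢ y →
              ¬ Zero (diff (v ∷ vs) y x ⨯ diff (v ∷ vs) z x)
    two-one x y z h h′ x≢y =
      Transverse.off-lines (tr z x h′) _ _ (tail-≢ h x≢y)
        ∘ Zero-resp (⨯-cong (same y x (≡.sym h)) ≋-refl)

    noncol : ∀ x y z → x ≢ y → x ≢ z → y ≢ z → ¬ Zero (diff (v ∷ vs) y x ⨯ diff (v ∷ vs) z x)
    noncol x y z x≢y x≢z y≢z with head x Bool.≟ head y | head x Bool.≟ head z
    ... | yes h | yes k =
      noncollinear _ _ _ (tail-≢ h x≢y) (tail-≢ k x≢z) (tail-≢ (≡.trans (≡.sym h) k) y≢z)
        ∘ Zero-resp (⨯-cong (same y x (≡.sym h)) (same z x (≡.sym k)))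
    ... | yes h | no k  = two-one x y z h (k ∘ ≡.sym) x≢y
    ... | no h  | yes k = two-one x z y k (h ∘ ≡.sym) x≢z ∘ ⨯-swap-zero
    ... | no h  | no k  = two-one y z x (both-differ h k) h y≢z
        ∘ Zero-resp (⨯-rotate (place (v ∷ vs) x) (place (v ∷ vs) y) (place (v ∷ vs) z))
      where
      both-differ : ∀ {a b c : Bool} → a ≢ b → a ≢ c → b ≡ c
      both-differ {true}  {true}  p q = contradiction ≡.refl p
      both-differ {true}  {false} {true}  p q = contradiction ≡.refl q
      both-differ {true}  {false} {false} p q = ≡.refl
      both-differ {false} {false} p q = contradiction ≡.refl p
      both-differ {false} {true} {false}  p q = contradiction ≡.refl q
      both-differ {false} {true} {true} p q = ≡.refl

    no5 : ∀ n → ¬ Zero n → (g : Fin 5 → Cube (suc m)) → (∀ i j → g i ≡ g j → i ≡ j) →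
          ¬ (∀ i j → n · diff (v ∷ vs) (g i) (g j) ≈ 0#)
    no5 n n≠0 g inj coplanar with five-colouring (head ∘ g)
    ... | inj₁ mono = no-five n n≠0 (tail ∘ g)
      (λ i j e → decidable-stable (i Fin.≟ j) λ i≢j → tail-≢ (mono i j) (i≢j ∘ inj i j) e)
      (λ i j → trans (sym (·-congˡ n (same (g i) (g j) (mono i j)))) (coplanar i j))
    -- The normal is orthogonal to two differences inside one copy and to one difference between the
    -- copies, so their determinant vanishes, against `off-planes`.
    ... | inj₂ (i , j , k , l , (i≢j , i≢k , j≢k) , (ij , ik , il)) =
      Transverse.off-planes (tr (g l) (g i) (il ∘ ≡.sym)) _ _ _
        (tail-≢ ij (i≢j ∘ inj i j)) (tail-≢ ik (i≢k ∘ inj i k)) (tail-≢ (≡.trans (≡.sym ij) ik) (j≢k ∘ inj j k))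
        (orthogonal⇒det≈0 n≠0 (diff vs (tail (g j)) (tail (g i))) (diff vs (tail (g k)) (tail (g i)))
          (diff (v ∷ vs) (g l) (g i)) (flat j ij) (flat k ik) (coplanar l i))
      where
      flat : ∀ j → head (g i) ≡ head (g j) → n · diff vs (tail (g j)) (tail (g i)) ≈ 0#
      flat j h = trans (sym (·-congˡ n (same (g j) (g i) (≡.sym h)))) (coplanar j i)

  scattered-[] : Scattered []
  scattered-[] = record
    { distinct = λ { [] [] ne → contradiction ≡.refl ne }
    ; noncollinear = λ { [] [] _ ne → contradiction ≡.refl ne }
    ; no-five = λ n n≠0 g inj → contradiction (inj 0F 1F (single (g 0F) (g 1F))) λ () }
    where single : (x y : Cube 0) → x ≡ y
          single [] [] = ≡.refl

  scattered : ∀ m → ∃ λ (vs : Vec Point m) → Scattered vs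
  scattered zero    = [] , scattered-[]
  scattered (suc m) =
    let vs , sc = scattered m
        v , tr  = generic-witness (generic-transverse sc)
    in v ∷ vs , scattered-∷ v sc tr

  -- Coplanar quadruples from equal sums.

  contribution : Bool → Carrier → Carrier
  contribution true  x = x
  contribution false x = 0#

  place-∷ : ∀ {m} v (vs : Vec Point m) b x i →
            place (v ∷ vs) (b ∷ x) i ≈ contribution b (v i) + place vs x i
  place-∷ v vs true  x i = refl
  place-∷ v vs false x i = sym (+-identityˡ _)

  place-additive : ∀ {m} (vs : Vec Point m) x y z w → sumCode x y ≡ sumCode z w →
                   (place vs x ⊕ place vs y) ≋ (place vs z ⊕ place vs w)
  place-additive []       []      []      []      []      _  = ≋-refl
  place-additive (v ∷ vs) (a ∷ x) (b ∷ y) (c ∷ z) (d ∷ w) eq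
    with d≡ , s≡ ← combine-injective _ (sumCode x y) _ (sumCode z w) eq
    with pointwise IH ← place-additive vs x y z w s≡ = pointwise λ i → begin
      place (v ∷ vs) (a ∷ x) i + place (v ∷ vs) (b ∷ y) i   ≈⟨ regroup a x b y i ⟩
      (contribution a (v i) + contribution b (v i)) + (place vs x i + place vs y i)
        ≈⟨ +-cong (contributions (digit-≡⇒ a b c d d≡) (v i)) (IH i) ⟩
      (contribution c (v i) + contribution d (v i)) + (place vs z i + place vs w i)
        ≈⟨ regroup c z d w i ⟨
      place (v ∷ vs) (c ∷ z) i + place (v ∷ vs) (d ∷ w) i   ∎
    where
    open ≈-Reasoning
    regroup : ∀ a x b y i → place (v ∷ vs) (a ∷ x) i + place (v ∷ vs) (b ∷ y) i ≈
              (contribution a (v i) + contribution b (v i)) + (place vs x i + place vs y i)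
    regroup a x b y i = trans (+-cong (place-∷ v vs a x i) (place-∷ v vs b y i)) (interchange _ _ _ _)
    contributions : ∀ {a b c d} → (a ≡ c × b ≡ d) ⊎ (a ≡ d × b ≡ c) → ∀ t →
                    contribution a t + contribution b t ≈ contribution c t + contribution d t
    contributions (inj₁ (≡.refl , ≡.refl)) t = refl
    contributions (inj₂ (≡.refl , ≡.refl)) t = +-comm _ _

  -- The plane is spanned at p by r and s. The fourth vertex lies on it because n · p + n · q = n ·
  -- r + n · s = 2 (n · p).
  parallelogram-plane : ∀ p q r s → ¬ Zero ((r ⊝ p) ⨯ (s ⊝ p)) → (p ⊕ q) ≋ (r ⊕ s) →
    Σ Hyperplane λ H → OnPlane H p × OnPlane H q × OnPlane H r × OnPlane H s
  parallelogram-plane p q r s nz p+q≋r+s =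
    record { normal = n ; offset = n · p ; normal≠0 = nz ∘ vanishing } ,
    refl , ∙-cancelˡ (n · p) _ _ n·p+n·q≈ , n·r≈n·p , n·s≈n·p
    where
    open ≈-Reasoning
    n = (r ⊝ p) ⨯ (s ⊝ p)
    n·r≈n·p : n · r ≈ n · p
    n·r≈n·p = x∙y⁻¹≈ε⇒x≈y _ _ (trans (sym (·-⊝ n r p)) (⨯-orthogonalˡ (r ⊝ p) (s ⊝ p)))
    n·s≈n·p : n · s ≈ n · p
    n·s≈n·p = x∙y⁻¹≈ε⇒x≈y _ _ (trans (sym (·-⊝ n s p)) (⨯-orthogonalʳ (r ⊝ p) (s ⊝ p)))
    n·p+n·q≈ : n · p + n · q ≈ n · p + n · p
    n·p+n·q≈ = begin
      n · p + n · q    ≈⟨ ·-⊕ n p q ⟨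
      n · (p ⊕ q)      ≈⟨ ·-congˡ n p+q≋r+s ⟩
      n · (r ⊕ s)      ≈⟨ ·-⊕ n r s ⟩
      n · r + n · s    ≈⟨ +-cong n·r≈n·p n·s≈n·p ⟩
      n · p + n · p    ∎

  module _ {m n} {vs : Vec Point m} (sc : Scattered vs)
           (b : Fin n → Cube m) (b-inj : ∀ i j → b i ≡ b j → i ≡ j) where
    open Scattered sc

    P : Fin n → Point
    P i = place vs (b i)

    P-distinct : DistinctPoints n P
    P-distinct i j i≢j same =
      distinct (b i) (b j) (i≢j ∘ b-inj i j) (vanishing λ c → x≈y⇒x∙y⁻¹≈ε (same c))

    P-atMost4 : AtMost4OnPlane P
    P-atMost4 H (f , f-inj , _ , on) =
      no-five normal (normal≠0 ∘ vanishes) (b ∘ f) (λ i j e → f-inj i j (b-inj _ _ e)) λ i j →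
        trans (·-⊝ normal (P (f i)) (P (f j))) (x≈y⇒x∙y⁻¹≈ε (trans (on i) (sym (on j))))
      where open Hyperplane H

    -- The two pairs with equal sums are the diagonals of a parallelogram, so one end of the first
    -- diagonal and both ends of the second form a triangle that fixes the plane.
    four-coplanar : ∀ S → 3 ℕ.^ m ℕ.< ⌊ ∣ S ∣ /2⌋ ℕ.* ⌊ ∣ S ∣ /2⌋ → ¬ GeneralPosition P S
    four-coplanar S large gp
      with x , y , z , w , uniq@((_ ∷ x≢z ∷ x≢w ∷ []) ∷ _ ∷ (z≢w ∷ []) ∷ _) , eq
             ← equal-sums ⌊ ∣ S ∣ /2⌋ (b ∘ halfMember S) (λ i j → halfMember-injective S i j ∘ b-inj _ _) large =
      let e = halfMember S
          apart : ∀ {i j} → i ≢ j → b (e i) ≢ b (e j)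
          apart i≢j = i≢j ∘ halfMember-injective S _ _ ∘ b-inj _ _
          H , on-x , on-y , on-z , on-w =
            parallelogram-plane (P (e x)) (P (e y)) (P (e z)) (P (e w))
              (noncollinear (b (e x)) (b (e z)) (b (e w)) (apart x≢z) (apart x≢w) (apart z≢w))
              (place-additive vs (b (e x)) (b (e y)) (b (e z)) (b (e w)) eq)
      in gp H (e ∘ lookup (x ∷ y ∷ z ∷ w ∷ []) ,
               (λ i j → lookup-injective uniq i j ∘ halfMember-injective S _ _) ,
               (λ i → member-∈ S _) ,
               λ { 0F → on-x ; 1F → on-y ; 2F → on-z ; 3F → on-w })

theorem5 : (ℝ : RealField) → AlphaN3IsLittleO ℝ
theorem5 ℝ k k≥1 = threshold k , λ n n≥N →
  let m , lo , hi = dyadic-bracket n (ℕ.≤-trans k≥1 (ℕ.≤-trans (ℕ.m≤m+n k _) n≥N))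
      vs , sc = scattered ℝ m
      b = λ i → bits m (inject≤ i lo)
      b-inj = λ i j → inject≤-injective lo lo i j ∘ bits-injective m _ _
  in P ℝ sc b b-inj , P-distinct ℝ sc b b-inj , P-atMost4 ℝ sc b b-inj , λ S gp →
     ℕ.≮⇒≥ λ n<ks →
       four-coplanar ℝ sc b b-inj S (half-square-exceeds k m n ∣ S ∣ k≥1 n≥N lo hi n<ks) gp
  where
  open Growth
  open Construction
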